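{- For every standard formula $\alpha$ and all formulas $\phi,\psi$ of the team language, the formula $(\alpha\to\phi\veebar\psi)\to(\alpha\to\phi)\veebar(\alpha\to\psi)$ is valid on every distributive general intuitionistic team Kripke frame.
   Context: **Language.** Fix a set $\mathsf{Prop}$ of propositional variables. Formulas of the team language are $\phi::=p\mid\bot\mid\phi\wedge\phi\mid\phi\vee\phi\mid\phi\veebar\phi\mid\phi\to\phi$; $\vee$ is the local and $\veebar$ the global disjunction; both bind more strongly than $\to$. Formulas without $\veebar$ are standard. **Frames.** For a nonempty set $W$ with a partial order $R$, teams are sets $t\subseteq W$; $R[t]=\{v\mid\exists w\in t:\ wRv\}$; and $tR^\circ s$ iff $\forall w\in t\,\exists v\in s\,(wRv)$ and $\forall v\in s\,\exists w\in t\,(wRv)$. A general intuitionistic team Kripke frame is $(W,R,\succcurlyeq,\Cup)$ where $W\neq\varnothing$, $R$ is a partial order on $W$, $\Cup$ is a binary operation on $\wp(W)$ such that $(\wp(W),\Cup,\varnothing)$ is a bounded join-semilattice ($\Cup$ associative, commutative, idempotent, $\varnothing\Cup t=t$), $\preccurlyeq$ is the induced partial order ($t\preccurlyeq s$ iff $t\Cup s=s$) with converse $\succcurlyeq$, and for all $t,s,s'\subseteq W$: - (a) if $tR^\circ s$ and $s\succcurlyeq s'$, then there is $t'\subseteq W$ with $t\succcurlyeq t'$ and $t'R^\circ s'$; - (b) $t\succcurlyeq\circ R^\circ s$ implies $R[t]\succcurlyeq s$, where $t\succcurlyeq\circ R^\circ s$ means there is $r\subseteq W$ with $t\succcurlyeq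 r$ and $rR^\circ s$; - (c) $R[t]\Cup R[s]=R[t\Cup s]$. The frame is distributive if for all $t,r,s\subseteq W$, $t\preccurlyeq r\Cup s$ implies that there are $r',s'\subseteq W$ with $r'\preccurlyeq r$, $s'\preccurlyeq s$ and $t=r'\Cup s'$. A model on the frame adds a valuation $V:\mathsf{Prop}\to\wp(W)$ persistent w.r.t. $R$ ($w\in V(p)$, $wRv$ imply $v\in V(p)$). **Generalized team semantics:** - $\mathfrak{M},t\models p$ iff $t\preccurlyeq V(p)$; - $\mathfrak{M},t\models\bot$ iff $t=\varnothing$; - $\mathfrak{M},t\models\phi\wedge\psi$ iff $\mathfrak{M},t\models\phi$ and $\mathfrak{M},t\models\psi$; - $\mathfrak{M},t\models\phi\vee\psi$ iff there are $s,r\subseteq W$ with $t\preccurlyeq s\Cup r$, $\mathfrak{M},s\models\phi$ and $\mathfrak{M},r\models\psi$; - $\mathfrak{M},t\models\phi\veebar\psi$ iff $\mathfrak{M},t\models\phi$ or $\mathfrak{M},t\models\psi$; - $\mathfrak{M},t\models\phi\to\psi$ iff for all $s\subseteq W$ with $t\succcurlyeq\circ R^\circ s$, $\mathfrak{M},s\models\phi$ implies $\mathfrak{M},s\models\psi$. A formula is valid on a frame if it holds at all teams in all models on the frame. -}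

module Defs where

open import Algebra.Core using (Op₂)
open import Algebra.Lattice.Structures using (IsBoundedJoinSemilattice)
open import Data.Product using (Σ-syntax; ∃-syntax; _×_)
open import Data.Sum using (_⊎_)
open import Level using (Level; Lift; suc; _⊔_)
open import Relation.Binary.Core using (Rel)
open import Relation.Binary.Structures using (IsPartialOrder)
open import Relation.Binary.PropositionalEquality using (_≡_)
open import Relation.Unary using (Pred; _∈_; _≐_)
open import Relation.Unary.Polymorphic using (∅)

private
  variable
    a ℓ : Level

infixr 7 _∧_
infixr 6 _∨_ _⩔_
infixr 5 _⇒_

-- `_∨_` is the local disjunction and `_⩔_` the global one.
data Formula (At : Set a) : Set a where
  var         : At → Formula At
  ⊥′          : Formula At
  _∧_ _∨_ _⩔_ : Formula At → Formula At → Formula At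
  _⇒_         : Formula At → Formula At → Formula At

-- Formulas in which `_⩔_` does not occur.
data Standard {At : Set a} : Formula At → Set a where
  var : ∀ p → Standard (var p)
  ⊥′  : Standard ⊥′
  _∧_ : ∀ {φ ψ} → Standard φ → Standard ψ → Standard (φ ∧ ψ)
  _∨_ : ∀ {φ ψ} → Standard φ → Standard ψ → Standard (φ ∨ ψ)
  _⇒_ : ∀ {φ ψ} → Standard φ → Standard ψ → Standard (φ ⇒ ψ)

-- The powerset of W is `Pred W ℓ` up to the extensional equality `_≐_`.
-- Relations on W live at the level of W, so that R[t] is again a team.
Team : Set ℓ → Set (suc ℓ)
Team {ℓ} W = Pred W ℓ

module _ {W : Set ℓ} (R : Rel W ℓ) where

  image : Team W → Team W
  image t v = ∃[ w ] (w ∈ t × R w v)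

  EgliMilner : Rel (Team W) ℓ
  EgliMilner t s =
      (∀ w → w ∈ t → ∃[ v ] (v ∈ s × R w v))
    × (∀ v → v ∈ s → ∃[ w ] (w ∈ t × R w v))

record Frame (ℓ : Level) : Set (suc (suc ℓ)) where
  infixr 6 _⋓_
  infix  4 _≼_ _≽_ _R°_ _≽∘R°_
  field
    W              : Set ℓ
    nonempty       : W
    R              : Rel W ℓ
    isPartialOrder : IsPartialOrder _≡_ R
    _⋓_            : Op₂ (Team W)
    -- This includes congruence: `_⋓_` is well defined on teams up to `_≐_`.
    isBoundedJoinSemilattice : IsBoundedJoinSemilattice _≐_ _⋓_ ∅

  R[_] : Team W → Team W
  R[_] = image R

  _R°_ : Rel (Team W) ℓ
  _R°_ = EgliMilner R

  _≼_ : Rel (Team W) ℓ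
  t ≼ s = t ⋓ s ≐ s

  _≽_ : Rel (Team W) ℓ
  t ≽ s = s ≼ t

  _≽∘R°_ : Rel (Team W) (suc ℓ)
  t ≽∘R° s = ∃[ r ] (t ≽ r × r R° s)

  field
    R°-≽   : ∀ t s s′ → t R° s → s ≽ s′ → ∃[ t′ ] (t ≽ t′ × t′ R° s′)
    ≽∘R°-≽ : ∀ t s → t ≽∘R° s → R[ t ] ≽ s
    R[]-⋓  : ∀ t s → R[ t ] ⋓ R[ s ] ≐ R[ t ⋓ s ]

Distributive : Frame ℓ → Set (suc ℓ)
Distributive F = ∀ t r s → t ≼ r ⋓ s →
    Σ[ r′ ∈ Team W ] Σ[ s′ ∈ Team W ] (r′ ≼ r × s′ ≼ s × t ≐ r′ ⋓ s′)
  where open Frame F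

record Model (At : Set a) (F : Frame ℓ) : Set (a ⊔ suc ℓ) where
  open Frame F
  field
    V          : At → Team W
    persistent : ∀ p w v → w ∈ V p → R w v → v ∈ V p

module _ {At : Set a} {F : Frame ℓ} (M : Model At F) where
  open Frame F
  open Model M

  infix 4 _⊨_

  -- `Lift` only raises the universe level to that of the clauses which
  -- quantify over teams.
  _⊨_ : Team W → Formula At → Set (suc ℓ)
  t ⊨ var p = Lift (suc ℓ) (t ≼ V p)
  t ⊨ ⊥′    = Lift (suc ℓ) (t ≐ ∅ {ℓ = ℓ})
  t ⊨ φ ∧ ψ = t ⊨ φ × t ⊨ ψ
  t ⊨ φ ∨ ψ = Σ[ s ∈ Team W ] Σ[ r ∈ Team W ] (t ≼ s ⋓ r × s ⊨ φ × r ⊨ ψ)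
  t ⊨ φ ⩔ ψ = t ⊨ φ ⊎ t ⊨ ψ
  t ⊨ φ ⇒ ψ = ∀ s → t ≽∘R° s → s ⊨ φ → s ⊨ ψ

Valid : {At : Set a} → Frame ℓ → Formula At → Set (a ⊔ suc ℓ)
Valid {At = At} F φ = (M : Model At F) (t : Team (Frame.W F)) → _⊨_ M t φ

{-# OPTIONS --safe #-}

-- By axioms (a) and (b), t ≽∘R° s holds exactly when s ≼ R[t], so the teams
-- over which an implication quantifies form a ≼-ideal. Distributivity and
-- axiom (c) then make every standard formula closed under ⋓. If s₁ and s₂
-- refuted α ⇒ φ and α ⇒ ψ at t, then s₁ ⋓ s₂ would satisfy α and be reached
-- from t, hence satisfy φ or ψ; by persistence along ≽ one of s₁, s₂ would too.
module Submission where

open import Defs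
open import Level using (Level; suc; lift)
open import Axiom.ExcludedMiddle using (ExcludedMiddle)
open import Algebra.Lattice.Structures using (IsBoundedJoinSemilattice)
open import Data.Empty using (⊥-elim)
open import Data.Product using (_,_)
open import Data.Sum using (inj₁; inj₂; map; [_,_]′)
open import Relation.Binary.Lattice.Bundles using (JoinSemilattice)
open import Relation.Binary.Structures using (IsPartialOrder)
import Relation.Binary.Lattice.Properties.JoinSemilattice as JoinSemilatticeProperties
import Relation.Binary.Reasoning.Setoid as ≈-Reasoning
open import Relation.Nullary using (yes; no)
open import Relation.Unary using (_≐_)
open import Relation.Unary.Polymorphic using (∅)

private
  variable
    a ℓ : Level

module FrameProperties (F : Frame ℓ) where
  open Frame F
  open IsBoundedJoinSemilattice _≐_ isBoundedJoinSemilattice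
    using (refl; sym; trans; setoid; isEquivalence; identityˡ)
    renaming (∨-cong to ⋓-cong; assoc to ⋓-assoc; comm to ⋓-comm; idem to ⋓-idem)

  ≼-reflexive : ∀ {t s} → t ≐ s → t ≼ s
  ≼-reflexive t≐s = trans (⋓-cong t≐s refl) (⋓-idem _)

  ≼-trans : ∀ {t s r} → t ≼ s → s ≼ r → t ≼ r
  ≼-trans {t} {s} {r} t≼s s≼r = begin
    t ⋓ r        ≈⟨ ⋓-cong refl s≼r ⟨
    t ⋓ s ⋓ r    ≈⟨ ⋓-assoc t s r ⟨
    (t ⋓ s) ⋓ r  ≈⟨ ⋓-cong t≼s refl ⟩
    s ⋓ r        ≈⟨ s≼r ⟩
    r            ∎
    where open ≈-Reasoning setoid

  ≼-antisym : ∀ {t s} → t ≼ s → s ≼ t → t ≐ s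
  ≼-antisym t≼s s≼t = trans (sym s≼t) (trans (⋓-comm _ _) t≼s)

  t≼t⋓s : ∀ t s → t ≼ t ⋓ s
  t≼t⋓s t s = trans (sym (⋓-assoc t t s)) (⋓-cong (⋓-idem t) refl)

  ⋓-least : ∀ {t s} r → t ≼ r → s ≼ r → t ⋓ s ≼ r
  ⋓-least r t≼r s≼r = trans (⋓-assoc _ _ r) (trans (⋓-cong refl s≼r) t≼r)

  -- Recasts the algebraic structure as an order, so that upper bounds and monotonicity of `_⋓_`
  -- come from the library.
  joinSemilattice : JoinSemilattice (suc ℓ) ℓ ℓ
  joinSemilattice = record
    { _≈_ = _≐_
    ; _≤_ = _≼_
    ; _∨_ = _⋓_
    ; isJoinSemilattice = record
      { isPartialOrder = record
        { isPreorder = record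
          { isEquivalence = isEquivalence
          ; reflexive     = ≼-reflexive
          ; trans         = ≼-trans
          }
        ; antisym = ≼-antisym
        }
      ; supremum = λ t s →
          t≼t⋓s t s , ≼-trans (t≼t⋓s s t) (≼-reflexive (⋓-comm s t)) , ⋓-least
      }
    }

  open JoinSemilattice joinSemilattice public
    using () renaming (x≤x∨y to x≼x⋓y; y≤x∨y to y≼x⋓y)
  open JoinSemilatticeProperties joinSemilattice public
    using () renaming (∨-monotonic to ⋓-monotonic)

  ≼∅⇒≐∅ : ∀ {t} → t ≼ ∅ → t ≐ ∅
  -- By the definition of `_≼_`, `identityˡ` says that ∅ is the least team.
  ≼∅⇒≐∅ t≼∅ = ≼-antisym t≼∅ (identityˡ _)

  R°-R[] : ∀ t → t R° R[ t ]
  R°-R[] t =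
    (λ w w∈t → w , (w , w∈t , R-refl) , R-refl) , (λ v v∈R[t] → v∈R[t])
    where open IsPartialOrder isPartialOrder using () renaming (refl to R-refl)

  -- Axiom (a) applied to `t R° R[ t ]`. Axiom (b) is the converse, so reachability from t can be
  -- handled as a bound by `R[ t ]`.
  ≼R[]⇒≽∘R° : ∀ {t s} → s ≼ R[ t ] → t ≽∘R° s
  ≼R[]⇒≽∘R° {t} {s} = R°-≽ t R[ t ] s (R°-R[] t)

  ≽∘R°-⋓ : ∀ {t s r} → t ≽∘R° s → t ≽∘R° r → t ≽∘R° s ⋓ r
  ≽∘R°-⋓ t→s t→r = ≼R[]⇒≽∘R° (⋓-least _ (≽∘R°-≽ _ _ t→s) (≽∘R°-≽ _ _ t→r))

module ModelProperties {At : Set a} {F : Frame ℓ} (M : Model At F) where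
  open Frame F
  open FrameProperties F
  open IsBoundedJoinSemilattice _≐_ isBoundedJoinSemilattice using (sym)

  private
    infix 4 _⊩_
    _⊩_ : Team W → Formula At → Set (suc ℓ)
    _⊩_ = _⊨_ M

  -- Apart from the recursion through `_∧_` and `_⩔_`, this rests on transitivity of `_≼_`: a
  -- further step down is absorbed by the bound in a local disjunction and by the first half of
  -- `_≽∘R°_`.
  ⊨-≽ : ∀ φ {t s} → t ≽ s → t ⊩ φ → s ⊩ φ
  ⊨-≽ (var p) s≼t (lift t≼V) = lift (≼-trans s≼t t≼V)
  ⊨-≽ ⊥′      s≼t (lift t≐∅) = lift (≼∅⇒≐∅ (≼-trans s≼t (≼-reflexive t≐∅)))
  ⊨-≽ (φ ∧ ψ) s≼t (t⊨φ , t⊨ψ) = ⊨-≽ φ s≼t t⊨φ , ⊨-≽ ψ s≼t t⊨ψ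
  ⊨-≽ (φ ∨ ψ) s≼t (r , r′ , t≼r⋓r′ , r⊨φ , r′⊨ψ) =
    r , r′ , ≼-trans s≼t t≼r⋓r′ , r⊨φ , r′⊨ψ
  ⊨-≽ (φ ⩔ ψ) s≼t = map (⊨-≽ φ s≼t) (⊨-≽ ψ s≼t)
  ⊨-≽ (φ ⇒ ψ) s≼t t⊨φ⇒ψ u (r , r≼s , rR°u) = t⊨φ⇒ψ u (r , ≼-trans r≼s s≼t , rR°u)

  -- Induction on standardness, which excludes `_⩔_`: there t and s may satisfy different disjuncts.
  ⊨-⋓ : Distributive F → ∀ {α} → Standard α → ∀ {t s} → t ⊩ α → s ⊩ α → t ⋓ s ⊩ α
  ⊨-⋓ _ (var p) (lift t≼V) (lift s≼V) = lift (⋓-least _ t≼V s≼V)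
  ⊨-⋓ _ ⊥′ (lift t≐∅) (lift s≐∅) =
    lift (≼∅⇒≐∅ (⋓-least _ (≼-reflexive t≐∅) (≼-reflexive s≐∅)))
  ⊨-⋓ d (α ∧ β) (t⊨α , t⊨β) (s⊨α , s⊨β) = ⊨-⋓ d α t⊨α s⊨α , ⊨-⋓ d β t⊨β s⊨β
  ⊨-⋓ d (α ∨ β) (t₁ , t₂ , t≼ , t₁⊨α , t₂⊨β) (s₁ , s₂ , s≼ , s₁⊨α , s₂⊨β) =
    t₁ ⋓ s₁ , t₂ ⋓ s₂ ,
    ⋓-least _
      (≼-trans t≼ (⋓-monotonic (x≼x⋓y t₁ s₁) (x≼x⋓y t₂ s₂)))
      (≼-trans s≼ (⋓-monotonic (y≼x⋓y t₁ s₁) (y≼x⋓y t₂ s₂))) ,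
    ⊨-⋓ d α t₁⊨α s₁⊨α , ⊨-⋓ d β t₂⊨β s₂⊨β
  ⊨-⋓ d (_⇒_ {φ} {ψ} α β) {t} {s} t⊨φ⇒ψ s⊨φ⇒ψ u t⋓s→u u⊨φ
    -- Since u lies below `R[ t ⋓ s ]`, it lies below `R[ t ] ⋓ R[ s ]` by axiom (c); distributivity
    -- splits it into a part reached from t and a part reached from s.
    with d u R[ t ] R[ s ]
           (≼-trans (≽∘R°-≽ _ _ t⋓s→u) (≼-reflexive (sym (R[]-⋓ t s))))
  ... | u₁ , u₂ , u₁≼R[t] , u₂≼R[s] , u≐u₁⋓u₂ =
    -- The outer `⊨-≽` only carries ψ across `u ≐ u₁ ⋓ u₂`; the inner ones pass φ from u down to
    -- each part.
    ⊨-≽ ψ (≼-reflexive u≐u₁⋓u₂)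
      (⊨-⋓ d β
        (t⊨φ⇒ψ u₁ (≼R[]⇒≽∘R° u₁≼R[t]) (⊨-≽ φ (≼-trans (x≼x⋓y u₁ u₂) u₁⋓u₂≼u) u⊨φ))
        (s⊨φ⇒ψ u₂ (≼R[]⇒≽∘R° u₂≼R[s]) (⊨-≽ φ (≼-trans (y≼x⋓y u₁ u₂) u₁⋓u₂≼u) u⊨φ)))
    where
    u₁⋓u₂≼u : u₁ ⋓ u₂ ≼ u
    u₁⋓u₂≼u = ≼-reflexive (sym u≐u₁⋓u₂)

proposition4p30 : ∀ {a ℓ : Level} → ExcludedMiddle (suc ℓ) →
    {At : Set a} (α φ ψ : Formula At) → Standard α →
    (F : Frame ℓ) → Distributive F →
    Valid F ((α ⇒ φ ⩔ ψ) ⇒ (α ⇒ φ) ⩔ (α ⇒ ψ))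
proposition4p30 em α φ ψ std F d M _ t _ t⊨α⇒φ⩔ψ with em {P = _⊨_ M t (α ⇒ φ)}
... | yes t⊨α⇒φ = inj₁ t⊨α⇒φ
... | no  t⊭α⇒φ = inj₂ t⊨α⇒ψ
  where
  open FrameProperties F
  open ModelProperties M

  t⊨α⇒ψ : _⊨_ M t (α ⇒ ψ)
  t⊨α⇒ψ s t→s s⊨α with em {P = _⊨_ M s ψ}
  ... | yes s⊨ψ = s⊨ψ
  -- If s fails ψ, every r reached from t that satisfies α also satisfies φ: `r ⋓ s` satisfies φ,
  -- which descends to r, or ψ, which would descend to s.
  ... | no  s⊭ψ = ⊥-elim (t⊭α⇒φ λ r t→r r⊨α →
    [ ⊨-≽ φ (x≼x⋓y r s) , (λ r⋓s⊨ψ → ⊥-elim (s⊭ψ (⊨-≽ ψ (y≼x⋓y r s) r⋓s⊨ψ))) ]′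
      (t⊨α⇒φ⩔ψ _ (≽∘R°-⋓ t→r t→s) (⊨-⋓ d std r⊨α s⊨α)))
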